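{- Let $p$ be a prime with $p\equiv 1\pmod 6$. Then there exists a Latin square $L$ of order $p$ that is orthogonal to $B_p$ and contains an intercalate.
   Context: $B_p$ is the Latin square of order $p$ with symbol $i+j\pmod p$ in cell $(i,j)$, $i,j\in\mathbb{Z}_p$. Two Latin squares of order $p$ are orthogonal if superimposing them yields each of the $p^2$ ordered pairs of symbols exactly once. An intercalate in a Latin square $L$ is a $2\times 2$ subsquare: rows $r_1\neq r_2$ and columns $c_1\neq c_2$ such that $L(r_1,c_1)=L(r_2,c_2)$ and $L(r_1,c_2)=L(r_2,c_1)$. -}

module Defs where

open import Data.Fin.Base using (Fin; toℕ)
open import Data.Fin.Properties using (nonZeroIndex)
open import Data.Nat.Base using (ℕ; _+_)
open import Data.Nat.DivMod using (_mod_)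
open import Data.Product.Base using (_×_; _,_; ∃-syntax)
open import Function.Definitions using (Bijective)
open import Relation.Binary.PropositionalEquality.Core using (_≡_; _≢_)

-- An n × n array with n symbols; the arguments are the row and the column.
Square : ℕ → Set
Square n = Fin n → Fin n → Fin n

record IsLatin {n : ℕ} (L : Square n) : Set where
  field
    row-bijective    : ∀ i → Bijective _≡_ _≡_ (λ j → L i j)
    column-bijective : ∀ j → Bijective _≡_ _≡_ (λ i → L i j)

-- ℤₙ is represented by Fin n.  The modulus is nonzero because Fin n is
-- inhabited by i, so no hypothesis on n is needed.
B : (n : ℕ) → Square n
B n i j = _mod_ (toℕ i + toℕ j) n {{nonZeroIndex i}}

-- Bijectivity says that each ordered pair of symbols occurs in exactly one
-- cell of the superposition.
Orthogonal : {n : ℕ} → Square n → Square n → Set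
Orthogonal {n} L M =
  Bijective {A = Fin n × Fin n} {B = Fin n × Fin n} _≡_ _≡_
    (λ { (i , j) → L i j , M i j })

HasIntercalate : {n : ℕ} → Square n → Set
HasIntercalate {n} L =
  ∃[ r₁ ] ∃[ r₂ ] ∃[ c₁ ] ∃[ c₂ ]
    (r₁ ≢ r₂ × c₁ ≢ c₂ × L r₁ c₁ ≡ L r₂ c₂ × L r₁ c₂ ≡ L r₂ c₁)

{-# OPTIONS --safe #-}

-- Let X, Y, Z be distinct nonzero squares modulo p, and put
--   L i j = Y (X - Z) i + X (Y - Z) j   if i + j is a square (0 included),
--   L i j = Z (X - Z) i + Z (Y - Z) j   otherwise.
-- Each branch is linear, hence injective on rows, columns and the lines on which
-- i + j is constant. If a square cell and a nonsquare cell of one row had the same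
-- symbol, their sums s and s′ would satisfy X s = Z s′, which is impossible; in one
-- column Y s = Z s′. So L is Latin and orthogonal to B p. The rows 0, 2 (Y - Z) and
-- the columns 4 Z, 2 (X + Z) form an intercalate as soon as none of 2 (X + Y),
-- 2 (X + Z), 2 (Y + Z) is a nonzero square. Such X, Y, Z are found in three cases:
--   * 2 is not a square: 16, -12, 9, where -3 is a square because p ≡ 1 (mod 3);
--   * 2 is a square and -1 is not: the three cube roots of unity;
--   * 2 and -1 are squares: x, 1, -1, where x is a square and x ± 1 are nonsquares.
module Submission where

open import Defs
open import Data.Nat.Base using (ℕ; _%_)
open import Data.Nat.Primality using (Prime)
open import Data.Product.Base using (_×_; ∃-syntax)
open import Relation.Binary.PropositionalEquality.Core using (_≡_)

import Algebra.Solver.Ring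
open import Algebra.Bundles using (CommutativeRing)
open import Algebra.Consequences.Propositional using (comm∧idˡ⇒id; comm∧invˡ⇒inv; comm∧distrˡ⇒distrʳ)
open import Algebra.Solver.Ring.AlmostCommutativeRing using (fromCommutativeRing; _-Raw-AlmostCommutative⟶_)
open import Data.Empty using (⊥)
open import Data.Fin.Base using (Fin; zero; suc; toℕ; fromℕ<; punchOut; _<_)
open import Data.Fin.Permutation using (Permutation; permutation)
open import Data.Fin.Properties using (_≟_; any?; _<?_; <-cmp; <-asym; <-trans; <-irrefl; suc-injective;
  toℕ-fromℕ<; toℕ-injective; toℕ<n; injective⇒≤; punchOut-injective)
open import Data.Integer.Base as ℤ using (ℤ; +_)
import Data.Integer.Divisibility.Signed as ℤ∣
import Data.Integer.DivMod as ℤ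
import Data.Integer.Properties as ℤ
import Data.Integer.Solver as ℤ
open import Data.Maybe.Base as Maybe using ()
open import Data.Nat.Base as ℕ using (zero; suc; NonZero)
import Data.Nat.Divisibility as ℕ
import Data.Nat.DivMod as ℕ
open import Data.Nat.Primality using (euclidsLemma; prime⇒nonZero)
import Data.Nat.Properties as ℕ
import Data.Nat.Solver as ℕ
open import Algebra.Properties.CommutativeMonoid.Sum ℕ.+-0-commutativeMonoid using (sum; sum-permute; sum-cong-≗; ∑-distrib-+)
open import Data.Product.Base using (_,_; proj₁; proj₂)
open import Data.Sum.Base using (_⊎_; inj₁; inj₂; [_,_]′)
open import Function.Base using (_∘_; id)
open import Function.Consequences.Propositional using (strictlySurjective⇒surjective)
open import Function.Definitions using (Injective; StrictlySurjective; Bijective)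
open import Level using (0ℓ)
open import Relation.Binary.Definitions using (tri<; tri≈; tri>)
open import Relation.Binary.PropositionalEquality
open import Relation.Nullary using (¬_; ¬?; Dec; yes; no; contradiction; _×-dec_)
open import Relation.Nullary.Decidable using (decidable-stable; dec⇒maybe)

IntercalatedMate : ℕ → Set
IntercalatedMate p = ∃[ L ] (IsLatin {p} L × Orthogonal L (B p) × HasIntercalate L)

-- Injections and surjections on a finite set

injective⇒strictlySurjective : ∀ {n} {f : Fin n → Fin n} → Injective _≡_ _≡_ f → StrictlySurjective _≡_ f
injective⇒strictlySurjective {suc n} {f} f-inj y with any? (λ x → f x ≟ y)
... | yes hit = hit
-- Punching out a missed value would inject a set of `suc n` points into one of `n` points.
... | no miss = contradiction (injective⇒≤ punch-inj) ℕ.1+n≰n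
  where
  y≢f : ∀ x → y ≢ f x
  y≢f x y≡fx = miss (x , sym y≡fx)

  punch-inj : Injective _≡_ _≡_ (λ x → punchOut (y≢f x))
  punch-inj {x} {x′} eq = f-inj (punchOut-injective (y≢f x) (y≢f x′) eq)

-- A section of `f` is injective, hence onto. So `x` and `x′` are values of the section, and
-- applying `f` shows that they come from the same argument.
strictlySurjective⇒injective : ∀ {n} {f : Fin n → Fin n} → StrictlySurjective _≡_ f → Injective _≡_ _≡_ f
strictlySurjective⇒injective {f = f} f-surj {x} {x′} fx≡fx′ = begin
  x                ≡⟨ proj₂ (section-surj x) ⟨
  section (proj₁ (section-surj x))    ≡⟨ cong section y≡y′ ⟩
  section (proj₁ (section-surj x′))   ≡⟨ proj₂ (section-surj x′) ⟩
  x′               ∎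
  where
  open ≡-Reasoning
  section = proj₁ ∘ f-surj
  section-surj = injective⇒strictlySurjective {f = section}
    (λ {y} {y′} eq → trans (sym (proj₂ (f-surj y))) (trans (cong f eq) (proj₂ (f-surj y′))))
  y≡y′ : proj₁ (section-surj x) ≡ proj₁ (section-surj x′)
  y≡y′ = begin
    _                                     ≡⟨ proj₂ (f-surj _) ⟨
    f (section (proj₁ (section-surj x)))  ≡⟨ cong f (proj₂ (section-surj x)) ⟩
    f x                                   ≡⟨ fx≡fx′ ⟩
    f x′                                  ≡⟨ cong f (proj₂ (section-surj x′)) ⟨
    f (section (proj₁ (section-surj x′))) ≡⟨ proj₂ (f-surj _) ⟩
    _                                     ∎

≮∧≯⇒≡ : ∀ {n} {i j : Fin n} → ¬ i < j → ¬ j < i → i ≡ j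
≮∧≯⇒≡ {i = i} {j} i≮j j≮i with <-cmp i j
... | tri< i<j _ _ = contradiction i<j i≮j
... | tri≈ _ i≡j _ = i≡j
... | tri> _ _ j<i = contradiction j<i j≮i

injective⇒bijective : ∀ {n} {f : Fin n → Fin n} → Injective _≡_ _≡_ f → Bijective _≡_ _≡_ f
injective⇒bijective f-inj = f-inj , strictlySurjective⇒surjective (injective⇒strictlySurjective f-inj)

-- Maps of order three without fixed points

module _ {n : ℕ} (σ : Fin n → Fin n) (σ³≡id : ∀ x → σ (σ (σ x)) ≡ x) where

  private
    andNot : ∀ {P Q : Set} → Dec P → Dec Q → ℕ
    andNot (yes _) (no _) = 1
    andNot _       _      = 0

    -- A cyclic word of three truth values that is not constant has exactly one change from no to
    -- yes. All yes would mean a < b < c < a; all no would mean a ≥ b ≥ c ≥ a, hence a = b.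
    andNot-cyclic : ∀ {a b c : Fin n} → a ≢ b → (ab : Dec (a < b)) (bc : Dec (b < c)) (ca : Dec (c < a)) →
                    andNot ab ca ℕ.+ andNot bc ab ℕ.+ andNot ca bc ≡ 1
    andNot-cyclic a≢b (yes a<b) (yes b<c) (yes c<a) = contradiction (<-trans a<b (<-trans b<c c<a)) (<-irrefl refl)
    andNot-cyclic a≢b (yes _) (yes _) (no _)  = refl
    andNot-cyclic a≢b (yes _) (no _)  (yes _) = refl
    andNot-cyclic a≢b (yes _) (no _)  (no _)  = refl
    andNot-cyclic a≢b (no _)  (yes _) (yes _) = refl
    andNot-cyclic a≢b (no _)  (yes _) (no _)  = refl
    andNot-cyclic a≢b (no _)  (no _)  (yes _) = refl
    andNot-cyclic a≢b (no a≮b) (no b≮c) (no c≮a) = contradiction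
      (toℕ-injective (ℕ.≤-antisym (ℕ.≤-trans (ℕ.≮⇒≥ c≮a) (ℕ.≮⇒≥ b≮c)) (ℕ.≮⇒≥ a≮b))) a≢b

    -- The second test is `σ (σ x) <? x` rather than its converse, so that the three points of an
    -- orbit share the same three comparisons.
    isLeast : Fin n → ℕ
    isLeast x = andNot (x <? σ x) (σ (σ x) <? x)

    isLeast-sum : ∀ x → σ x ≢ x → isLeast x ℕ.+ isLeast (σ x) ℕ.+ isLeast (σ (σ x)) ≡ 1
    isLeast-sum x σx≢x = begin
      isLeast x ℕ.+ isLeast (σ x) ℕ.+ isLeast (σ (σ x))
        ≡⟨ cong₂ (λ y z → isLeast x ℕ.+ andNot (σ x <? σ (σ x)) (y <? σ x) ℕ.+ andNot (σ (σ x) <? z) (σ z <? σ (σ x))) (σ³≡id x) (σ³≡id x) ⟩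
      andNot (x <? σ x) (σ (σ x) <? x) ℕ.+ andNot (σ x <? σ (σ x)) (x <? σ x) ℕ.+ andNot (σ (σ x) <? x) (σ x <? σ (σ x))
        ≡⟨ andNot-cyclic (σx≢x ∘ sym) (x <? σ x) (σ x <? σ (σ x)) (σ (σ x) <? x) ⟩
      1 ∎
      where open ≡-Reasoning

    sum-ones : ∀ n → sum {n} (λ _ → 1) ≡ n
    sum-ones zero    = refl
    sum-ones (suc n) = cong suc (sum-ones n)

  -- Each orbit has exactly one least point. Summing `isLeast-sum` over all points gives `n`; since
  -- `σ` is a permutation, the three resulting sums are equal.
  fixedPointFree⇒3∣n : (∀ x → σ x ≢ x) → 3 ℕ.∣ n
  fixedPointFree⇒3∣n σx≢x = ℕ.divides (sum isLeast) (begin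
    n                                           ≡⟨ sum-ones n ⟨
    sum {n} (λ _ → 1)                           ≡⟨ sum-cong-≗ (λ x → isLeast-sum x (σx≢x x)) ⟨
    sum (λ x → isLeast x ℕ.+ isLeast (σ x) ℕ.+ isLeast (σ (σ x)))
      ≡⟨ ∑-distrib-+ (λ x → isLeast x ℕ.+ isLeast (σ x)) (isLeast ∘ σ ∘ σ) ⟩
    sum (λ x → isLeast x ℕ.+ isLeast (σ x)) ℕ.+ sum (isLeast ∘ σ ∘ σ)
      ≡⟨ cong₂ ℕ._+_ (∑-distrib-+ isLeast (isLeast ∘ σ)) (sym (trans (sum-permute isLeast σ-perm) (sum-permute (isLeast ∘ σ) σ-perm))) ⟩
    sum isLeast ℕ.+ sum (isLeast ∘ σ) ℕ.+ sum isLeast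
      ≡⟨ cong (λ s → sum isLeast ℕ.+ s ℕ.+ sum isLeast) (sum-permute isLeast σ-perm) ⟨
    sum isLeast ℕ.+ sum isLeast ℕ.+ sum isLeast ≡⟨ solve 1 (λ s → s :+ s :+ s := s :* con 3) refl (sum isLeast) ⟩
    sum isLeast ℕ.* 3                           ∎)
    where
    open ≡-Reasoning
    open ℕ.+-*-Solver
    σ-perm : Permutation n n
    σ-perm = permutation σ (σ ∘ σ) σ³≡id σ³≡id

-- Arithmetic modulo p

small-multiple : ∀ {p n} → n ℕ.< p → p ℕ.∣ n → n ≡ 0
small-multiple {n = zero}  _   _   = refl
small-multiple {n = suc _} n<p p∣n = contradiction p∣n (ℕ.>⇒∤ n<p)

remainder-unique : ∀ {p r s} k → r ℕ.< p → s ℕ.< p → + r ≡ + s ℤ.+ k ℤ.* + p → r ≡ s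
remainder-unique {p} {r} {s} k r<p s<p eq =
  ℤ.+-injective (ℤ.i-j≡0⇒i≡j (+ r) (+ s) (ℤ.∣i∣≡0⇒i≡0 (small-multiple ∣r-s∣<p p∣∣r-s∣)))
  where
  ∣r-s∣<p : ℤ.∣ + r ℤ.- + s ∣ ℕ.< p
  ∣r-s∣<p = ℕ.≤-<-trans
    (subst (λ z → ℤ.∣ z ∣ ℕ.≤ r ℕ.⊔ s) (sym (ℤ.m-n≡m⊖n r s)) (ℤ.∣m⊝n∣≤m⊔n r s))
    (ℕ.⊔-pres-<m r<p s<p)

  p∣∣r-s∣ : p ℕ.∣ ℤ.∣ + r ℤ.- + s ∣
  p∣∣r-s∣ = ℤ∣.∣⇒∣ᵤ (ℤ∣.divides k (trans (cong (ℤ._- + s) eq)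
    (solve 2 (λ s kp → (s :+ kp) :- s := kp) refl (+ s) (k ℤ.* + p))))
    where open ℤ.+-*-Solver

module Modular (p : ℕ) .{{_ : NonZero p}} where

  infixl 6 _+_
  infixl 7 _*_
  infix  8 -_

  private
    division : ∀ a → a ≡ + (a ℤ.%ℕ p) ℤ.+ (a ℤ./ℕ p) ℤ.* + p
    division a = ℤ.a≡a%ℕn+[a/ℕn]*n a p

  -- Sealed, so that later goals keep the shape of ring expressions instead of unfolding to
  -- remainders; the equations in the next block give access to the bodies.
  opaque
    red : ℤ → Fin p
    red a = fromℕ< (ℤ.n%ℕd<d a p)

    _+_ _*_ : Fin p → Fin p → Fin p
    x + y = red (+ toℕ x ℤ.+ + toℕ y)
    x * y = red (+ toℕ x ℤ.* + toℕ y)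

    -_ : Fin p → Fin p
    - x = red (ℤ.- + toℕ x)

  opaque
    unfolding red

    toℕ-red : ∀ a → toℕ (red a) ≡ a ℤ.%ℕ p
    toℕ-red a = toℕ-fromℕ< (ℤ.n%ℕd<d a p)

    +-def : ∀ x y → x + y ≡ red (+ toℕ x ℤ.+ + toℕ y)
    +-def x y = refl

    *-def : ∀ x y → x * y ≡ red (+ toℕ x ℤ.* + toℕ y)
    *-def x y = refl

    neg-def : ∀ x → - x ≡ red (ℤ.- + toℕ x)
    neg-def x = refl

    -- On nonnegative integers the integer remainder computes to the natural one, which is what `B`
    -- uses.
    B≡+ : ∀ i j → B p i j ≡ i + j
    B≡+ i j = refl

  red-+-multiple : ∀ a k → red (a ℤ.+ k ℤ.* + p) ≡ red a
  red-+-multiple a k = toℕ-injective (begin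
    toℕ (red b)  ≡⟨ toℕ-red b ⟩
    b ℤ.%ℕ p     ≡⟨ remainder-unique ((a ℤ./ℕ p) ℤ.+ k ℤ.- (b ℤ./ℕ p)) (ℤ.n%ℕd<d b p) (ℤ.n%ℕd<d a p) eq ⟩
    a ℤ.%ℕ p     ≡⟨ toℕ-red a ⟨
    toℕ (red a)  ∎)
    where
    open ≡-Reasoning
    open ℤ.+-*-Solver
    b = a ℤ.+ k ℤ.* + p

    shift : ∀ s r q q′ → s ℤ.+ q′ ℤ.* + p ≡ r ℤ.+ q ℤ.* + p ℤ.+ k ℤ.* + p →
            s ≡ r ℤ.+ (q ℤ.+ k ℤ.- q′) ℤ.* + p
    shift s r q q′ h = begin
      s ≡⟨ solve 3 (λ s q′ P → s := s :+ q′ :* P :- q′ :* P) refl s q′ (+ p) ⟩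
      s ℤ.+ q′ ℤ.* + p ℤ.- q′ ℤ.* + p ≡⟨ cong (ℤ._- q′ ℤ.* + p) h ⟩
      r ℤ.+ q ℤ.* + p ℤ.+ k ℤ.* + p ℤ.- q′ ℤ.* + p
        ≡⟨ solve 5 (λ r q k q′ P → r :+ q :* P :+ k :* P :- q′ :* P := r :+ (q :+ k :- q′) :* P)
                 refl r q k q′ (+ p) ⟩
      r ℤ.+ (q ℤ.+ k ℤ.- q′) ℤ.* + p ∎

    eq : + (b ℤ.%ℕ p) ≡ + (a ℤ.%ℕ p) ℤ.+ ((a ℤ./ℕ p) ℤ.+ k ℤ.- (b ℤ./ℕ p)) ℤ.* + p
    eq = shift (+ (b ℤ.%ℕ p)) (+ (a ℤ.%ℕ p)) (a ℤ./ℕ p) (b ℤ./ℕ p) (trans (sym (division b)) (cong (ℤ._+ k ℤ.* + p) (division a)))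

  red-toℕ : ∀ x → red (+ toℕ x) ≡ x
  red-toℕ x = toℕ-injective (trans (toℕ-red (+ toℕ x)) (ℕ.m<n⇒m%n≡m (toℕ<n x)))

  red-+ : ∀ a b → red (a ℤ.+ b) ≡ red a + red b
  red-+ a b = begin
    red (a ℤ.+ b)          ≡⟨ cong₂ (λ a b → red (a ℤ.+ b)) (division a) (division b) ⟩
    red ((ra ℤ.+ qa ℤ.* + p) ℤ.+ (rb ℤ.+ qb ℤ.* + p))
      ≡⟨ cong red (solve 5 (λ ra qa rb qb P →
           (ra :+ qa :* P) :+ (rb :+ qb :* P) := (ra :+ rb) :+ (qa :+ qb) :* P)
           refl ra qa rb qb (+ p)) ⟩
    red ((ra ℤ.+ rb) ℤ.+ (qa ℤ.+ qb) ℤ.* + p) ≡⟨ red-+-multiple _ (qa ℤ.+ qb) ⟩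
    red (ra ℤ.+ rb)        ≡⟨ cong₂ (λ r s → red (+ r ℤ.+ + s)) (toℕ-red a) (toℕ-red b) ⟨
    red (+ toℕ (red a) ℤ.+ + toℕ (red b)) ≡⟨ +-def (red a) (red b) ⟨
    red a + red b          ∎
    where
    open ≡-Reasoning
    open ℤ.+-*-Solver
    ra = + (a ℤ.%ℕ p); qa = a ℤ./ℕ p; rb = + (b ℤ.%ℕ p); qb = b ℤ./ℕ p

  red-* : ∀ a b → red (a ℤ.* b) ≡ red a * red b
  red-* a b = begin
    red (a ℤ.* b)          ≡⟨ cong₂ (λ a b → red (a ℤ.* b)) (division a) (division b) ⟩
    red ((ra ℤ.+ qa ℤ.* + p) ℤ.* (rb ℤ.+ qb ℤ.* + p))
      ≡⟨ cong red (solve 5 (λ ra qa rb qb P →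
           (ra :+ qa :* P) :* (rb :+ qb :* P)
             := (ra :* rb) :+ (ra :* qb :+ qa :* rb :+ qa :* qb :* P) :* P)
           refl ra qa rb qb (+ p)) ⟩
    red ((ra ℤ.* rb) ℤ.+ (ra ℤ.* qb ℤ.+ qa ℤ.* rb ℤ.+ qa ℤ.* qb ℤ.* + p) ℤ.* + p)
      ≡⟨ red-+-multiple _ (ra ℤ.* qb ℤ.+ qa ℤ.* rb ℤ.+ qa ℤ.* qb ℤ.* + p) ⟩
    red (ra ℤ.* rb)        ≡⟨ cong₂ (λ r s → red (+ r ℤ.* + s)) (toℕ-red a) (toℕ-red b) ⟨
    red (+ toℕ (red a) ℤ.* + toℕ (red b)) ≡⟨ *-def (red a) (red b) ⟨
    red a * red b          ∎
    where
    open ≡-Reasoning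
    open ℤ.+-*-Solver
    ra = + (a ℤ.%ℕ p); qa = a ℤ./ℕ p; rb = + (b ℤ.%ℕ p); qb = b ℤ./ℕ p

  red-neg : ∀ a → red (ℤ.- a) ≡ - red a
  red-neg a = begin
    red (ℤ.- a)                        ≡⟨ cong (λ a → red (ℤ.- a)) (division a) ⟩
    red (ℤ.- (ra ℤ.+ qa ℤ.* + p))
      ≡⟨ cong red (solve 3 (λ ra qa P → :- (ra :+ qa :* P) := :- ra :+ :- qa :* P) refl ra qa (+ p)) ⟩
    red (ℤ.- ra ℤ.+ ℤ.- qa ℤ.* + p)    ≡⟨ red-+-multiple _ (ℤ.- qa) ⟩
    red (ℤ.- ra)                       ≡⟨ cong (λ r → red (ℤ.- + r)) (toℕ-red a) ⟨
    red (ℤ.- + toℕ (red a))            ≡⟨ neg-def (red a) ⟨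
    - red a                            ∎
    where
    open ≡-Reasoning
    open ℤ.+-*-Solver
    ra = + (a ℤ.%ℕ p); qa = a ℤ./ℕ p

  red≡0⇒∣ : ∀ a → red a ≡ red ℤ.0ℤ → p ℕ.∣ ℤ.∣ a ∣
  red≡0⇒∣ a eq = ℤ∣.∣⇒∣ᵤ (ℤ∣.divides (a ℤ./ℕ p) (begin
    a                                          ≡⟨ division a ⟩
    + (a ℤ.%ℕ p) ℤ.+ (a ℤ./ℕ p) ℤ.* + p        ≡⟨ cong (λ r → + r ℤ.+ (a ℤ./ℕ p) ℤ.* + p) a%p≡0 ⟩
    ℤ.0ℤ ℤ.+ (a ℤ./ℕ p) ℤ.* + p                ≡⟨ ℤ.+-identityˡ _ ⟩
    (a ℤ./ℕ p) ℤ.* + p                         ∎))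
    where
    open ≡-Reasoning
    a%p≡0 : a ℤ.%ℕ p ≡ 0
    a%p≡0 = begin
      a ℤ.%ℕ p      ≡⟨ toℕ-red a ⟨
      toℕ (red a)   ≡⟨ cong toℕ eq ⟩
      toℕ (red ℤ.0ℤ) ≡⟨ toℕ-red ℤ.0ℤ ⟩
      0 ℕ.% p       ≡⟨ ℕ.m<n⇒m%n≡m (ℕ.>-nonZero⁻¹ p) ⟩
      0             ∎

  0# 1# : Fin p
  0# = red ℤ.0ℤ
  1# = red ℤ.1ℤ

  private
    -- Every residue is `red` of an integer, so an identity need only be checked on such values,
    -- where it is inherited from ℤ through `red-+`, `red-*` and `red-neg`.
    reduce₃ : (f g : Fin p → Fin p → Fin p → Fin p) →
              (∀ a b c → f (red a) (red b) (red c) ≡ g (red a) (red b) (red c)) →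
              ∀ x y z → f x y z ≡ g x y z
    reduce₃ f g h x y z =
      subst (λ x → f x y z ≡ g x y z) (red-toℕ x)
        (subst (λ y → f _ y z ≡ g _ y z) (red-toℕ y)
          (subst (λ z → f _ _ z ≡ g _ _ z) (red-toℕ z) (h _ _ _)))

    reduce₂ : (f g : Fin p → Fin p → Fin p) → (∀ a b → f (red a) (red b) ≡ g (red a) (red b)) →
              ∀ x y → f x y ≡ g x y
    reduce₂ f g h x y = reduce₃ (λ x y _ → f x y) (λ x y _ → g x y) (λ a b _ → h a b) x y x

    reduce₁ : (f g : Fin p → Fin p) → (∀ a → f (red a) ≡ g (red a)) → ∀ x → f x ≡ g x
    reduce₁ f g h x = reduce₃ (λ x _ _ → f x) (λ x _ _ → g x) (λ a _ _ → h a) x x x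

  open ≡-Reasoning

  +-assoc : ∀ x y z → (x + y) + z ≡ x + (y + z)
  +-assoc = reduce₃ _ _ λ a b c → begin
    (red a + red b) + red c    ≡⟨ cong (_+ red c) (red-+ a b) ⟨
    red (a ℤ.+ b) + red c      ≡⟨ red-+ (a ℤ.+ b) c ⟨
    red ((a ℤ.+ b) ℤ.+ c)      ≡⟨ cong red (ℤ.+-assoc a b c) ⟩
    red (a ℤ.+ (b ℤ.+ c))      ≡⟨ red-+ a (b ℤ.+ c) ⟩
    red a + red (b ℤ.+ c)      ≡⟨ cong (_+_ (red a)) (red-+ b c) ⟩
    red a + (red b + red c)    ∎

  +-comm : ∀ x y → x + y ≡ y + x
  +-comm = reduce₂ _ _ λ a b →
    trans (sym (red-+ a b)) (trans (cong red (ℤ.+-comm a b)) (red-+ b a))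

  +-identityˡ : ∀ x → 0# + x ≡ x
  +-identityˡ = reduce₁ _ _ λ a → trans (sym (red-+ ℤ.0ℤ a)) (cong red (ℤ.+-identityˡ a))

  -‿inverseˡ : ∀ x → - x + x ≡ 0#
  -‿inverseˡ = reduce₁ _ _ λ a → begin
    - red a + red a        ≡⟨ cong (_+ red a) (red-neg a) ⟨
    red (ℤ.- a) + red a    ≡⟨ red-+ (ℤ.- a) a ⟨
    red (ℤ.- a ℤ.+ a)      ≡⟨ cong red (ℤ.+-inverseˡ a) ⟩
    0#                     ∎

  *-assoc : ∀ x y z → (x * y) * z ≡ x * (y * z)
  *-assoc = reduce₃ _ _ λ a b c → begin
    (red a * red b) * red c    ≡⟨ cong (_* red c) (red-* a b) ⟨
    red (a ℤ.* b) * red c      ≡⟨ red-* (a ℤ.* b) c ⟨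
    red ((a ℤ.* b) ℤ.* c)      ≡⟨ cong red (ℤ.*-assoc a b c) ⟩
    red (a ℤ.* (b ℤ.* c))      ≡⟨ red-* a (b ℤ.* c) ⟩
    red a * red (b ℤ.* c)      ≡⟨ cong (_*_ (red a)) (red-* b c) ⟩
    red a * (red b * red c)    ∎

  *-comm : ∀ x y → x * y ≡ y * x
  *-comm = reduce₂ _ _ λ a b →
    trans (sym (red-* a b)) (trans (cong red (ℤ.*-comm a b)) (red-* b a))

  *-identityˡ : ∀ x → 1# * x ≡ x
  *-identityˡ = reduce₁ _ _ λ a → trans (sym (red-* ℤ.1ℤ a)) (cong red (ℤ.*-identityˡ a))

  *-distribˡ-+ : ∀ x y z → x * (y + z) ≡ x * y + x * z
  *-distribˡ-+ = reduce₃ _ _ λ a b c → begin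
    red a * (red b + red c)              ≡⟨ cong (_*_ (red a)) (red-+ b c) ⟨
    red a * red (b ℤ.+ c)                ≡⟨ red-* a (b ℤ.+ c) ⟨
    red (a ℤ.* (b ℤ.+ c))                ≡⟨ cong red (ℤ.*-distribˡ-+ a b c) ⟩
    red (a ℤ.* b ℤ.+ a ℤ.* c)            ≡⟨ red-+ (a ℤ.* b) (a ℤ.* c) ⟩
    red (a ℤ.* b) + red (a ℤ.* c)        ≡⟨ cong₂ _+_ (red-* a b) (red-* a c) ⟩
    red a * red b + red a * red c        ∎

  commutativeRing : CommutativeRing 0ℓ 0ℓ
  commutativeRing = record
    { Carrier = Fin p ; _≈_ = _≡_ ; _+_ = _+_ ; _*_ = _*_ ; -_ = -_ ; 0# = 0# ; 1# = 1#
    ; isCommutativeRing = record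
      { isRing = record
        { +-isAbelianGroup = record
          { isGroup = record
            { isMonoid = record
              { isSemigroup = record
                { isMagma = record { isEquivalence = isEquivalence ; ∙-cong = cong₂ _+_ }
                ; assoc = +-assoc }
              ; identity = comm∧idˡ⇒id +-comm +-identityˡ }
            ; inverse = comm∧invˡ⇒inv +-comm -‿inverseˡ
            ; ⁻¹-cong = cong -_ }
          ; comm = +-comm }
        ; *-cong = cong₂ _*_
        ; *-assoc = *-assoc
        ; *-identity = comm∧idˡ⇒id *-comm *-identityˡ
        ; distrib = *-distribˡ-+ , comm∧distrˡ⇒distrʳ *-comm *-distribˡ-+ }
      ; *-comm = *-comm } }

  private
    -- Integer coefficients let the solver do arithmetic with numerals: `con (+ 2)` stands for
    -- `red (+ 2)`.
    red-morphism : CommutativeRing.rawRing ℤ.+-*-commutativeRing -Raw-AlmostCommutative⟶ fromCommutativeRing commutativeRing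
    red-morphism = record
      { ⟦_⟧ = red ; +-homo = red-+ ; *-homo = red-* ; -‿homo = red-neg
      ; 0-homo = refl ; 1-homo = refl }

  module Solver = Algebra.Solver.Ring (CommutativeRing.rawRing ℤ.+-*-commutativeRing)
    (fromCommutativeRing commutativeRing) red-morphism
    (λ a b → Maybe.map (cong red) (dec⇒maybe (a ℤ.≟ b)))

  open CommutativeRing commutativeRing public using (_-_; +-group)

-- The field of residues modulo a prime

module PrimeField (p : ℕ) (p-prime : Prime p) where

  instance
    p-nonZero : NonZero p
    p-nonZero = prime⇒nonZero p-prime

  open Modular p public
  open import Algebra.Properties.Group +-group public using (x∙y⁻¹≈ε⇒x≈y; x≈y⇒x∙y⁻¹≈ε)
  open Solver

  F : Set
  F = Fin p

  2# : F
  2# = red (+ 2)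

  *-zeroˡ : ∀ x → 0# * x ≡ 0#
  *-zeroˡ = solve 1 (λ x → con ℤ.0ℤ :* x := con ℤ.0ℤ) refl

  *-zeroʳ : ∀ x → x * 0# ≡ 0#
  *-zeroʳ = solve 1 (λ x → x :* con ℤ.0ℤ := con ℤ.0ℤ) refl

  x*y≡0⇒x≡0∨y≡0 : ∀ x y → x * y ≡ 0# → x ≡ 0# ⊎ y ≡ 0#
  x*y≡0⇒x≡0∨y≡0 x y xy≡0 =
    [ inj₁ ∘ ∣⇒≡0 x , inj₂ ∘ ∣⇒≡0 y ]′ (euclidsLemma (toℕ x) (toℕ y) p-prime
      (subst (p ℕ.∣_) (ℤ.∣i*j∣≡∣i∣*∣j∣ (+ toℕ x) (+ toℕ y))
        (red≡0⇒∣ _ (trans (sym (*-def x y)) xy≡0))))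
    where
    ∣⇒≡0 : ∀ x → p ℕ.∣ toℕ x → x ≡ 0#
    ∣⇒≡0 x p∣x = trans (sym (red-toℕ x)) (cong (red ∘ +_) (small-multiple (toℕ<n x) p∣x))

  *-≢0 : ∀ {x y} → x ≢ 0# → y ≢ 0# → x * y ≢ 0#
  *-≢0 x≢0 y≢0 xy≡0 = [ x≢0 , y≢0 ]′ (x*y≡0⇒x≡0∨y≡0 _ _ xy≡0)

  *≡0⇒ʳ≡0 : ∀ {x y} → x ≢ 0# → x * y ≡ 0# → y ≡ 0#
  *≡0⇒ʳ≡0 x≢0 xy≡0 = [ (λ x≡0 → contradiction x≡0 x≢0) , id ]′ (x*y≡0⇒x≡0∨y≡0 _ _ xy≡0)

  -≢0 : ∀ {x y} → x ≢ y → x - y ≢ 0#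
  -≢0 x≢y = x≢y ∘ x∙y⁻¹≈ε⇒x≈y _ _

  *-cancelˡ : ∀ {x y z} → x ≢ 0# → x * y ≡ x * z → y ≡ z
  *-cancelˡ {x} {y} {z} x≢0 eq = x∙y⁻¹≈ε⇒x≈y y z (*≡0⇒ʳ≡0 x≢0 (trans
    (solve 3 (λ x y z → x :* (y :- z) := x :* y :- x :* z) refl x y z) (x≈y⇒x∙y⁻¹≈ε eq)))

  abstract
    -- Multiplication by `x` is injective on a finite set, so it attains 1.
    inverse : ∀ {x} → x ≢ 0# → ∃[ y ] x * y ≡ 1#
    inverse x≢0 = injective⇒strictlySurjective (*-cancelˡ x≢0) 1#

  1≢0 : 1# ≢ 0#
  1≢0 1≡0 = contradiction (ℕ.∣1⇒≡1 (red≡0⇒∣ (+ 1) 1≡0)) λ { refl → contradiction p-prime λ () }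

  x²≡y²⇒x≡±y : ∀ x y → x * x ≡ y * y → x ≡ y ⊎ x ≡ - y
  x²≡y²⇒x≡±y x y eq = [ inj₁ ∘ x∙y⁻¹≈ε⇒x≈y x y , inj₂ ∘ (λ h → x∙y⁻¹≈ε⇒x≈y x (- y)
      (trans (solve 2 (λ x y → x :- :- y := x :+ y) refl x y) h)) ]′
    (x*y≡0⇒x≡0∨y≡0 (x - y) (x + y) (trans
      (solve 2 (λ x y → (x :- y) :* (x :+ y) := x :* x :- y :* y) refl x y) (x≈y⇒x∙y⁻¹≈ε eq)))

  -- Squares and nonsquares

  IsSquare : F → Set
  IsSquare x = ∃[ u ] u * u ≡ x

  abstract
    square? : ∀ x → Dec (IsSquare x)
    square? x = any? (λ u → u * u ≟ x)

  square-0 : IsSquare 0#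
  square-0 = 0# , *-zeroˡ 0#

  □1 : IsSquare 1#
  □1 = 1# , *-identityˡ 1#

  square-* : ∀ {x y} → IsSquare x → IsSquare y → IsSquare (x * y)
  square-* (u , refl) (v , refl) =
    u * v , solve 2 (λ u v → (u :* v) :* (u :* v) := (u :* u) :* (v :* v)) refl u v

  square-root-≢0 : ∀ {x} → x ≢ 0# → ∀ u → u * u ≡ x → u ≢ 0#
  square-root-≢0 x≢0 u u²≡x u≡0 = x≢0 (trans (sym u²≡x) (trans (cong (_* u) u≡0) (*-zeroˡ u)))

  -- The quotient of the two given roots is a root of `y`. This replaces the quadratic character
  -- below.
  square-cancel : ∀ {x y} → x ≢ 0# → IsSquare x → IsSquare (x * y) → IsSquare y
  square-cancel {x} {y} x≢0 (u , u²≡x) (v , v²≡xy) = v * u⁻¹ , (begin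
    (v * u⁻¹) * (v * u⁻¹)           ≡⟨ solve 2 (λ v w → (v :* w) :* (v :* w) := (v :* v) :* (w :* w)) refl v u⁻¹ ⟩
    (v * v) * (u⁻¹ * u⁻¹)           ≡⟨ cong (_* (u⁻¹ * u⁻¹)) (trans v²≡xy (cong (_* y) (sym u²≡x))) ⟩
    (u * u * y) * (u⁻¹ * u⁻¹)       ≡⟨ solve 3 (λ u w y → (u :* u :* y) :* (w :* w) := (u :* w) :* (u :* w) :* y) refl u u⁻¹ y ⟩
    (u * u⁻¹) * (u * u⁻¹) * y       ≡⟨ cong (λ e → e * e * y) uu⁻¹≡1 ⟩
    1# * 1# * y                     ≡⟨ solve 1 (λ y → con ℤ.1ℤ :* con ℤ.1ℤ :* y := y) refl y ⟩
    y                               ∎)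
    where
    open ≡-Reasoning
    u⁻¹ = proj₁ (inverse (square-root-≢0 x≢0 u u²≡x))
    uu⁻¹≡1 = proj₂ (inverse (square-root-≢0 x≢0 u u²≡x))

  nonsquare-≢0 : ∀ {x} → ¬ IsSquare x → x ≢ 0#
  nonsquare-≢0 ¬□x x≡0 = ¬□x (subst IsSquare (sym x≡0) square-0)

  NonsquareOrZero : F → Set
  NonsquareOrZero s = IsSquare s → s ≡ 0#

  -- Products of nonsquares in odd characteristic

  module Odd (2≢0 : 2# ≢ 0#) where

    x≡-x⇒x≡0 : ∀ {x} → x ≡ - x → x ≡ 0#
    x≡-x⇒x≡0 {x} eq = *≡0⇒ʳ≡0 2≢0 (trans
      (solve 1 (λ x → con (+ 2) :* x := x :- :- x) refl x) (x≈y⇒x∙y⁻¹≈ε eq))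

    private
      -- One of each pair ±x is sent to x², the other to g x²; for a nonsquare g
      -- the resulting map is injective, so that every element is a square or g
      -- times a square.
      twist : ∀ {x} → F → Dec (x < - x) → F
      twist {x} g (yes _) = x * x
      twist {x} g (no  _) = g * (x * x)

      -- Otherwise `g` would be the square of x / y.
      x²≡gy²⇒y≡0 : ∀ {g x y} → ¬ IsSquare g → x * x ≡ g * (y * y) → y ≡ 0#
      x²≡gy²⇒y≡0 {g} {x} {y} ¬□g eq = decidable-stable (y ≟ 0#) λ y≢0 →
        ¬□g (square-cancel (*-≢0 y≢0 y≢0) (y , refl) (x , trans eq (*-comm g (y * y))))

      x²≡gy²⇒x≡y : ∀ {g x y} → ¬ IsSquare g → x * x ≡ g * (y * y) → x ≡ y
      x²≡gy²⇒x≡y {g} {x} {y} ¬□g eq = trans x≡0 (sym y≡0)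
        where
        y≡0 = x²≡gy²⇒y≡0 ¬□g eq
        x≡0 : x ≡ 0#
        x≡0 = decidable-stable (x ≟ 0#) λ x≢0 → *-≢0 x≢0 x≢0 (trans eq
          (trans (cong (λ y → g * (y * y)) y≡0)
            (solve 1 (λ g → g :* (con ℤ.0ℤ :* con ℤ.0ℤ) := con ℤ.0ℤ) refl g)))

      -‿flip : ∀ {x y} → x ≡ - y → y ≡ - x
      -‿flip {x} {y} x≡-y = trans (solve 1 (λ y → y := :- :- y) refl y) (cong (λ z → - z) (sym x≡-y))

      -- Equal values in one branch give x = ±y. If x = -y, the comparisons of `x` with -x and of
      -- `y` with -y become those of `x` with `y`: two yes answers contradict each other, two no
      -- answers force x = y. Values in different branches agree only at zero.
      twist-injective : ∀ {g} → ¬ IsSquare g → ∀ {x y} (x? : Dec (x < - x)) (y? : Dec (y < - y)) →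
                        twist g x? ≡ twist g y? → x ≡ y
      twist-injective ¬□g {x} {y} (yes x<-x) (yes y<-y) eq =
        [ id , (λ x≡-y → contradiction (subst (x <_) (sym (-‿flip x≡-y)) x<-x)
                                       (<-asym (subst (y <_) (sym x≡-y) y<-y))) ]′ (x²≡y²⇒x≡±y x y eq)
      twist-injective ¬□g (yes _) (no _) eq = x²≡gy²⇒x≡y ¬□g eq
      twist-injective ¬□g (no _) (yes _) eq = sym (x²≡gy²⇒x≡y ¬□g (sym eq))
      twist-injective {g} ¬□g {x} {y} (no x≮-x) (no y≮-y) eq =
        [ id , (λ x≡-y → ≮∧≯⇒≡ (x≮-x ∘ subst (x <_) (-‿flip x≡-y)) (y≮-y ∘ subst (y <_) x≡-y)) ]′
          (x²≡y²⇒x≡±y x y (*-cancelˡ (nonsquare-≢0 ¬□g) eq))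

    -- The twisted squaring map is onto, so the nonsquare `x` has the form g y², and g x = (g y)².
    nonsquare-*-nonsquare : ∀ {g x} → ¬ IsSquare g → ¬ IsSquare x → IsSquare (g * x)
    nonsquare-*-nonsquare {g} {x} ¬□g ¬□x =
      from-twist (y <? - y) twisted-y≡x
      where
      twisted-surj : StrictlySurjective _≡_ (λ y → twist g (y <? - y))
      twisted-surj = injective⇒strictlySurjective λ {x} {y} → twist-injective ¬□g (x <? - x) (y <? - y)

      y = proj₁ (twisted-surj x)
      twisted-y≡x = proj₂ (twisted-surj x)

      from-twist : ∀ {y} (y? : Dec (y < - y)) → twist g y? ≡ x → IsSquare (g * x)
      from-twist {y} (yes _) eq = contradiction (y , eq) ¬□x
      from-twist {y} (no _)  eq = g * y , trans
        (solve 2 (λ g y → (g :* y) :* (g :* y) := g :* (g :* (y :* y))) refl g y) (cong (g *_) eq)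

    abstract
      -- If everything were a square, squaring would be onto, hence injective; but 1 and -1 have the
      -- same square.
      nonsquare : ∃[ g ] ¬ IsSquare g
      nonsquare = decidable-stable (any? (λ g → ¬? (square? g))) λ none →
        2≢0 (trans (solve 0 (con (+ 2) := con (+ 1) :- :- con (+ 1)) refl) (x≈y⇒x∙y⁻¹≈ε {1#} { - 1#}
          (squaring-injective none (solve 0 (con (+ 1) :* con (+ 1) := :- con (+ 1) :* :- con (+ 1)) refl))))
        where
        squaring-injective : ¬ (∃[ g ] ¬ IsSquare g) → Injective _≡_ _≡_ (λ x → x * x)
        squaring-injective none = strictlySurjective⇒injective λ g → decidable-stable (square? g) λ ¬□g → none (g , ¬□g)

  -- The square L built from three squares: Latin and orthogonal

  module FromSquares
    {X Y Z : F} (X≢0 : X ≢ 0#) (Y≢0 : Y ≢ 0#) (Z≢0 : Z ≢ 0#)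
    (X≢Y : X ≢ Y) (X≢Z : X ≢ Z) (Y≢Z : Y ≢ Z)
    (□X : IsSquare X) (□Y : IsSquare Y) (□Z : IsSquare Z)
    where

    v w : F → F → F
    v i j = Y * (X - Z) * i + X * (Y - Z) * j
    w i j = Z * (X - Z) * i + Z * (Y - Z) * j

    -- The decision is an argument, so that proofs can split on it although `square?` is abstract.
    choose : ∀ {s} → Dec (IsSquare s) → F → F → F
    choose (yes _) a b = a
    choose (no _)  a b = b

    L : F → F → F
    L i j = choose (square? (i + j)) (v i j) (w i j)

    X-Z≢0 = -≢0 X≢Z
    Y-Z≢0 = -≢0 Y≢Z

    cancel-difference : ∀ {c a b d e} → c ≢ 0# → d - e ≡ c * (a - b) → d ≡ e → a ≡ b
    cancel-difference c≢0 eq d≡e = x∙y⁻¹≈ε⇒x≈y _ _ (*≡0⇒ʳ≡0 c≢0 (trans (sym eq) (x≈y⇒x∙y⁻¹≈ε d≡e)))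

    square-transfer : ∀ {U s s′} → IsSquare U → U * s ≡ Z * s′ → IsSquare s → IsSquare s′
    square-transfer □U Us≡Zs′ □s = square-cancel Z≢0 □Z (subst IsSquare Us≡Zs′ (square-* □U □s))

    -- The coefficients of `i` in `v` and `w` differ by (X - Z)(Y - Z), exactly what completes `j`
    -- and `j′` to the two cell sums.
    row-mixed : ∀ i j j′ → v i j - w i j′ ≡ (Y - Z) * (X * (i + j) - Z * (i + j′))
    row-mixed i j j′ = solve 6 (λ X Y Z i j j′ →
      (Y :* (X :- Z) :* i :+ X :* (Y :- Z) :* j) :- (Z :* (X :- Z) :* i :+ Z :* (Y :- Z) :* j′)
        := (Y :- Z) :* (X :* (i :+ j) :- Z :* (i :+ j′))) refl X Y Z i j j′

    row-injective : ∀ {i j j′} (s? : Dec (IsSquare (i + j))) (s′? : Dec (IsSquare (i + j′))) →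
      choose s? (v i j) (w i j) ≡ choose s′? (v i j′) (w i j′) → j ≡ j′
    row-injective {i} {j} {j′} (yes _) (yes _) = cancel-difference (*-≢0 X≢0 Y-Z≢0)
      (solve 6 (λ X Y Z i j j′ →
        (Y :* (X :- Z) :* i :+ X :* (Y :- Z) :* j) :- (Y :* (X :- Z) :* i :+ X :* (Y :- Z) :* j′)
          := X :* (Y :- Z) :* (j :- j′)) refl X Y Z i j j′)
    row-injective {i} {j} {j′} (no _)  (no _)  = cancel-difference (*-≢0 Z≢0 Y-Z≢0)
      (solve 6 (λ X Y Z i j j′ →
        (Z :* (X :- Z) :* i :+ Z :* (Y :- Z) :* j) :- (Z :* (X :- Z) :* i :+ Z :* (Y :- Z) :* j′)
          := Z :* (Y :- Z) :* (j :- j′)) refl X Y Z i j j′)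
    row-injective {i} {j} {j′} (yes □s) (no ¬□s′) eq = contradiction
      (square-transfer □X (cancel-difference Y-Z≢0 (row-mixed i j j′) eq) □s) ¬□s′
    row-injective {i} {j} {j′} (no ¬□s) (yes □s′) eq = contradiction
      (square-transfer □X (cancel-difference Y-Z≢0 (row-mixed i j′ j) (sym eq)) □s′) ¬□s

    column-mixed : ∀ j i i′ → v i j - w i′ j ≡ (X - Z) * (Y * (i + j) - Z * (i′ + j))
    column-mixed j i i′ = solve 6 (λ X Y Z i i′ j →
      (Y :* (X :- Z) :* i :+ X :* (Y :- Z) :* j) :- (Z :* (X :- Z) :* i′ :+ Z :* (Y :- Z) :* j)
        := (X :- Z) :* (Y :* (i :+ j) :- Z :* (i′ :+ j))) refl X Y Z i i′ j

    column-injective : ∀ {j i i′} (s? : Dec (IsSquare (i + j))) (s′? : Dec (IsSquare (i′ + j))) →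
      choose s? (v i j) (w i j) ≡ choose s′? (v i′ j) (w i′ j) → i ≡ i′
    column-injective {j} {i} {i′} (yes _) (yes _) = cancel-difference (*-≢0 Y≢0 X-Z≢0)
      (solve 6 (λ X Y Z i i′ j →
        (Y :* (X :- Z) :* i :+ X :* (Y :- Z) :* j) :- (Y :* (X :- Z) :* i′ :+ X :* (Y :- Z) :* j)
          := Y :* (X :- Z) :* (i :- i′)) refl X Y Z i i′ j)
    column-injective {j} {i} {i′} (no _)  (no _)  = cancel-difference (*-≢0 Z≢0 X-Z≢0)
      (solve 6 (λ X Y Z i i′ j →
        (Z :* (X :- Z) :* i :+ Z :* (Y :- Z) :* j) :- (Z :* (X :- Z) :* i′ :+ Z :* (Y :- Z) :* j)
          := Z :* (X :- Z) :* (i :- i′)) refl X Y Z i i′ j)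
    column-injective {j} {i} {i′} (yes □s) (no ¬□s′) eq = contradiction
      (square-transfer □Y (cancel-difference X-Z≢0 (column-mixed j i i′) eq) □s) ¬□s′
    column-injective {j} {i} {i′} (no ¬□s) (yes □s′) eq = contradiction
      (square-transfer □Y (cancel-difference X-Z≢0 (column-mixed j i′ i) (sym eq)) □s′) ¬□s

    L-isLatin : IsLatin L
    L-isLatin = record
      { row-bijective    = λ i → injective⇒bijective (row-injective (square? _) (square? _))
      ; column-bijective = λ j → injective⇒bijective (column-injective (square? _) (square? _))
      }

    -- Where i + j = s a single branch applies, and both branches have slope Z (X - Y) in `i`.
    diagonal-injective : ∀ {s i i′} (s? : Dec (IsSquare s)) →
      choose s? (v i (s - i)) (w i (s - i)) ≡ choose s? (v i′ (s - i′)) (w i′ (s - i′)) → i ≡ i′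
    diagonal-injective {s} {i} {i′} (yes _) = cancel-difference (*-≢0 Z≢0 (-≢0 X≢Y))
      (solve 6 (λ X Y Z i i′ s →
        (Y :* (X :- Z) :* i :+ X :* (Y :- Z) :* (s :- i)) :- (Y :* (X :- Z) :* i′ :+ X :* (Y :- Z) :* (s :- i′))
          := Z :* (X :- Y) :* (i :- i′)) refl X Y Z i i′ s)
    diagonal-injective {s} {i} {i′} (no _)  = cancel-difference (*-≢0 Z≢0 (-≢0 X≢Y))
      (solve 6 (λ X Y Z i i′ s →
        (Z :* (X :- Z) :* i :+ Z :* (Y :- Z) :* (s :- i)) :- (Z :* (X :- Z) :* i′ :+ Z :* (Y :- Z) :* (s :- i′))
          := Z :* (X :- Y) :* (i :- i′)) refl X Y Z i i′ s)

    L-on-diagonal : F → F → F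
    L-on-diagonal s i = choose (square? s) (v i (s - i)) (w i (s - i))

    i+[s-i]≡s : ∀ i s → i + (s - i) ≡ s
    i+[s-i]≡s = solve 2 (λ i s → i :+ (s :- i) := s) refl

    j≡i+j-i : ∀ i j → j ≡ (i + j) - i
    j≡i+j-i = solve 2 (λ i j → j := (i :+ j) :- i) refl

    L≡L-on-diagonal : ∀ i s → L i (s - i) ≡ L-on-diagonal s i
    L≡L-on-diagonal i s = cong (λ t → choose (square? t) (v i (s - i)) (w i (s - i))) (i+[s-i]≡s i s)

    -- The symbol of `B p` fixes the line i + j = s; on that line `L` is injective in `i`, hence
    -- takes every symbol once.
    L-orthogonal : Orthogonal L (B p)
    L-orthogonal = superposition-injective , strictlySurjective⇒surjective superposition-surjective
      where
      superposition : F × F → F × F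
      superposition (i , j) = L i j , B p i j

      superposition-injective : Injective _≡_ _≡_ superposition
      superposition-injective {i , j} {i′ , j′} eq = cong₂ _,_ i≡i′
        (trans (j≡i+j-i i j) (trans (cong₂ _-_ sums i≡i′) (sym (j≡i+j-i i′ j′))))
        where
        sums : i + j ≡ i′ + j′
        sums = trans (sym (B≡+ i j)) (trans (cong proj₂ eq) (B≡+ i′ j′))

        L-diagonal : ∀ {i j s} → i + j ≡ s → L i j ≡ L-on-diagonal s i
        L-diagonal {i} {j} {s} i+j≡s = trans
          (cong (L i) (trans (j≡i+j-i i j) (cong (_- i) i+j≡s))) (L≡L-on-diagonal i s)

        i≡i′ : i ≡ i′
        i≡i′ = diagonal-injective (square? (i′ + j′))
          (trans (sym (L-diagonal sums)) (trans (cong proj₁ eq) (L-diagonal refl)))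

      superposition-surjective : StrictlySurjective _≡_ superposition
      superposition-surjective (k , s) = (i , s - i) , cong₂ _,_
        (trans (L≡L-on-diagonal i s) (proj₂ preimage))
        (trans (B≡+ i (s - i)) (i+[s-i]≡s i s))
        where
        preimage = injective⇒strictlySurjective (diagonal-injective {s} (square? s)) k
        i = proj₁ preimage

    -- The intercalate

    choose-square : ∀ {s} (s? : Dec (IsSquare s)) {a b} → IsSquare s → choose s? a b ≡ a
    choose-square (yes _)  □s = refl
    choose-square (no ¬□s) □s = contradiction □s ¬□s

    L-square : ∀ {i j} → IsSquare (i + j) → L i j ≡ v i j
    L-square {i} {j} □s = choose-square (square? (i + j)) □s

    -- The two branches differ by (X - Z)(Y - Z)(i + j).
    v≡w : ∀ {i j} → i + j ≡ 0# → v i j ≡ w i j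
    v≡w {i} {j} s≡0 = x∙y⁻¹≈ε⇒x≈y _ _ (trans
      (solve 5 (λ X Y Z i j →
        (Y :* (X :- Z) :* i :+ X :* (Y :- Z) :* j) :- (Z :* (X :- Z) :* i :+ Z :* (Y :- Z) :* j)
          := (X :- Z) :* (Y :- Z) :* (i :+ j)) refl X Y Z i j)
      (trans (cong ((X - Z) * (Y - Z) *_) s≡0) (*-zeroʳ _)))

    L-nonsquare : ∀ {i j} → (IsSquare (i + j) → i + j ≡ 0#) → L i j ≡ w i j
    L-nonsquare {i} {j} = by-case (square? (i + j))
      where
      by-case : ∀ (s? : Dec (IsSquare (i + j))) → (IsSquare (i + j) → i + j ≡ 0#) → choose s? (v i j) (w i j) ≡ w i j
      by-case (yes □s) s≡0 = v≡w (s≡0 □s)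
      by-case (no _)   _   = refl

    -- The sums i + j in the four cells are 4 Z, 2 (X + Z), 2 (Y + Z) and 2 (X + Y).
    L-hasIntercalate : 2# ≢ 0# → NonsquareOrZero (2# * (X + Y)) → NonsquareOrZero (2# * (X + Z)) →
      NonsquareOrZero (2# * (Y + Z)) → HasIntercalate L
    L-hasIntercalate 2≢0 ¬□₁ ¬□₂ ¬□₃ =
      r₁ , r₂ , c₁ , c₂ ,
      (λ r₁≡r₂ → *-≢0 2≢0 Y-Z≢0 (sym r₁≡r₂)) ,
      (λ c₁≡c₂ → *-≢0 2≢0 X-Z≢0 (trans
        (solve 2 (λ X Z → con (+ 2) :* (X :- Z) := con (+ 2) :* (X :+ Z) :- con (+ 4) :* Z) refl X Z)
        (x≈y⇒x∙y⁻¹≈ε (sym c₁≡c₂)))) ,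
      trans (L-square square₁₁) (trans corner (sym (L-nonsquare nonsquare₂₂))) ,
      trans (L-nonsquare nonsquare₁₂) (trans anti-corner (sym (L-nonsquare nonsquare₂₁)))
      where
      r₁ r₂ c₁ c₂ : F
      r₁ = 0#
      r₂ = 2# * (Y - Z)
      c₁ = red (+ 4) * Z
      c₂ = 2# * (X + Z)

      square₁₁ : IsSquare (r₁ + c₁)
      square₁₁ = subst IsSquare (solve 1 (λ Z → con (+ 2) :* con (+ 2) :* Z := con ℤ.0ℤ :+ con (+ 4) :* Z) refl Z)
        (square-* (2# , refl) □Z)

      nonsquare₁₂ : NonsquareOrZero (r₁ + c₂)
      nonsquare₁₂ = subst NonsquareOrZero
        (solve 2 (λ X Z → con (+ 2) :* (X :+ Z) := con ℤ.0ℤ :+ con (+ 2) :* (X :+ Z)) refl X Z) ¬□₂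

      nonsquare₂₁ : NonsquareOrZero (r₂ + c₁)
      nonsquare₂₁ = subst NonsquareOrZero
        (solve 2 (λ Y Z → con (+ 2) :* (Y :+ Z) := con (+ 2) :* (Y :- Z) :+ con (+ 4) :* Z) refl Y Z) ¬□₃

      nonsquare₂₂ : NonsquareOrZero (r₂ + c₂)
      nonsquare₂₂ = subst NonsquareOrZero
        (solve 3 (λ X Y Z → con (+ 2) :* (X :+ Y) := con (+ 2) :* (Y :- Z) :+ con (+ 2) :* (X :+ Z)) refl X Y Z) ¬□₁

      -- Both sides equal 4 X Z (Y - Z).
      corner : v r₁ c₁ ≡ w r₂ c₂
      corner = solve 3 (λ X Y Z →
        Y :* (X :- Z) :* con ℤ.0ℤ :+ X :* (Y :- Z) :* (con (+ 4) :* Z)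
          := Z :* (X :- Z) :* (con (+ 2) :* (Y :- Z)) :+ Z :* (Y :- Z) :* (con (+ 2) :* (X :+ Z))) refl X Y Z

      -- Both sides equal 2 Z (X + Z)(Y - Z).
      anti-corner : w r₁ c₂ ≡ w r₂ c₁
      anti-corner = solve 3 (λ X Y Z →
        Z :* (X :- Z) :* con ℤ.0ℤ :+ Z :* (Y :- Z) :* (con (+ 2) :* (X :+ Z))
          := Z :* (X :- Z) :* (con (+ 2) :* (Y :- Z)) :+ Z :* (Y :- Z) :* (con (+ 4) :* Z)) refl X Y Z

    intercalatedMate : 2# ≢ 0# → NonsquareOrZero (2# * (X + Y)) → NonsquareOrZero (2# * (X + Z)) →
      NonsquareOrZero (2# * (Y + Z)) → IntercalatedMate p
    intercalatedMate 2≢0 ¬□₁ ¬□₂ ¬□₃ = L , L-isLatin , L-orthogonal , L-hasIntercalate 2≢0 ¬□₁ ¬□₂ ¬□₃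

-- A primitive cube root of unity for p ≡ 1 (mod 6)

module OneModSix (p : ℕ) (p-prime : Prime p) (p%6≡1 : p % 6 ≡ 1) where

  open PrimeField p p-prime
  open Solver

  -- Here p + 1 = 6 k + 2, so 3 would divide 2.
  3∤1+p : ¬ 3 ℕ.∣ suc p
  3∤1+p 3∣1+p = ℕ.>⇒∤ (ℕ.≤-refl {3}) (ℕ.∣m+n∣m⇒∣n {m = p ℕ./ 6 ℕ.* 6} {n = 2}
    (subst (3 ℕ.∣_) (trans (cong suc (trans (ℕ.m≡m%n+[m/n]*n p 6) (cong (ℕ._+ p ℕ./ 6 ℕ.* 6) p%6≡1)))
                           (ℕ.+-comm 2 (p ℕ./ 6 ℕ.* 6))) 3∣1+p)
    (ℕ.∣n⇒∣m*n (p ℕ./ 6) (ℕ.divides 2 refl)))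

  -- A prime dividing `k` would be below 6, hence equal to its remainder 1 modulo 6.
  small-≢0 : ∀ k .{{_ : NonZero k}} → k ℕ.< 6 → red (+ k) ≢ 0#
  small-≢0 k k<6 k≡0 = contradiction (subst Prime p≡1 p-prime) λ ()
    where
    p≡1 : p ≡ 1
    p≡1 = trans (sym (ℕ.m<n⇒m%n≡m (ℕ.≤-<-trans (ℕ.∣⇒≤ (red≡0⇒∣ (+ k) k≡0)) k<6))) p%6≡1

  2≢0 : 2# ≢ 0#
  2≢0 = small-≢0 2 (ℕ.m≤m+n 3 3)

  3≢0 : red (+ 3) ≢ 0#
  3≢0 = small-≢0 3 (ℕ.m≤m+n 4 2)

  5≢0 : red (+ 5) ≢ 0#
  5≢0 = small-≢0 5 ℕ.≤-refl

  open Odd 2≢0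

  private
    -- x ↦ 1 / (1 - x) on the projective line, with zero in the role of ∞. It has order
    -- three on p + 1 ≡ 2 (mod 3) points, hence a fixed point x, and -x is a root of
    -- ω² + ω + 1.
    möbius-finite : ∀ x → Dec (x ≡ 1#) → Fin (suc p)
    möbius-finite x (yes _)  = zero
    möbius-finite x (no x≢1) = suc (proj₁ (inverse (-≢0 (x≢1 ∘ sym))))

    möbius : Fin (suc p) → Fin (suc p)
    möbius zero    = suc 0#
    möbius (suc x) = möbius-finite x (x ≟ 1#)

    möbius-1 : ∀ {x} → x ≡ 1# → möbius (suc x) ≡ zero
    möbius-1 {x} = by-case (x ≟ 1#)
      where
      by-case : (d : Dec (x ≡ 1#)) → x ≡ 1# → möbius-finite x d ≡ zero
      by-case (yes _)  _   = refl
      by-case (no x≢1) x≡1 = contradiction x≡1 x≢1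

    [1-1]*y≢1 : ∀ {x y} → x ≡ 1# → (1# - x) * y ≢ 1#
    [1-1]*y≢1 {x} {y} x≡1 eq = 1≢0 (trans (sym eq) (trans (cong (λ x → (1# - x) * y) x≡1)
      (solve 1 (λ y → (con ℤ.1ℤ :- con ℤ.1ℤ) :* y := con ℤ.0ℤ) refl y)))

    möbius-≢1 : ∀ {x y} → (1# - x) * y ≡ 1# → möbius (suc x) ≡ suc y
    möbius-≢1 {x} {y} eq = by-case (x ≟ 1#)
      where
      by-case : (d : Dec (x ≡ 1#)) → möbius-finite x d ≡ suc y
      by-case (yes x≡1) = contradiction eq ([1-1]*y≢1 x≡1)
      by-case (no x≢1)  = cong suc (*-cancelˡ (-≢0 (x≢1 ∘ sym)) (trans (proj₂ (inverse (-≢0 (x≢1 ∘ sym)))) (sym eq)))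

    möbius-0 : ∀ {x} → x ≡ 0# → möbius (suc x) ≡ suc 1#
    möbius-0 x≡0 = möbius-≢1 (trans (cong (λ x → (1# - x) * 1#) x≡0)
      (solve 0 ((con ℤ.1ℤ :- con ℤ.0ℤ) :* con ℤ.1ℤ := con ℤ.1ℤ) refl))

    -- The cycle ∞, 0, 1 is followed by hand. Any other `x` goes to y = 1 / (1 - x), then to z = 1 /
    -- (1 - y), and (1 - z) x = 1.
    möbius³≡id : ∀ x → möbius (möbius (möbius x)) ≡ x
    möbius³≡id zero = trans (cong möbius (möbius-0 refl)) (möbius-1 refl)
    möbius³≡id (suc x) = by-case (x ≟ 0#) (x ≟ 1#)
      where
      by-case : Dec (x ≡ 0#) → Dec (x ≡ 1#) → möbius (möbius (möbius (suc x))) ≡ suc x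
      by-case (yes x≡0) _ = trans (cong (möbius ∘ möbius) (möbius-0 x≡0))
        (trans (cong möbius (möbius-1 refl)) (cong suc (sym x≡0)))
      by-case (no _) (yes x≡1) = trans (cong (möbius ∘ möbius) (möbius-1 x≡1))
        (trans (möbius-0 refl) (cong suc (sym x≡1)))
      by-case (no x≢0) (no x≢1) = trans (cong (möbius ∘ möbius) (möbius-≢1 eq-y))
        (trans (cong möbius (möbius-≢1 eq-z)) (möbius-≢1 (*-cancelˡ y≢0 (trans identity
          (trans (cong₂ (λ a b → y * 1# + ((z - 1#) * (a - 1#) + (b - 1#))) eq-y eq-z)
            (solve 2 (λ y z → y :* con ℤ.1ℤ :+ ((z :- con ℤ.1ℤ) :* (con ℤ.1ℤ :- con ℤ.1ℤ) :+ (con ℤ.1ℤ :- con ℤ.1ℤ))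
              := y :* con ℤ.1ℤ) refl y z))))))
        where
        1-x = inverse (-≢0 (x≢1 ∘ sym))
        y = proj₁ 1-x
        eq-y : (1# - x) * y ≡ 1#
        eq-y = proj₂ 1-x
        y≢0 : y ≢ 0#
        y≢0 y≡0 = 1≢0 (trans (sym eq-y) (trans (cong ((1# - x) *_) y≡0) (*-zeroʳ _)))
        y≢1 : y ≢ 1#
        y≢1 y≡1 = x≢0 (trans (solve 1 (λ x → x := con ℤ.1ℤ :- (con ℤ.1ℤ :- x) :* con ℤ.1ℤ) refl x)
          (trans (cong (λ y → 1# - (1# - x) * y) (sym y≡1)) (x≈y⇒x∙y⁻¹≈ε (sym eq-y))))
        1-y = inverse (-≢0 (y≢1 ∘ sym))
        z = proj₁ 1-y
        eq-z : (1# - y) * z ≡ 1#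
        eq-z = proj₂ 1-y
        -- Both brackets after `y * 1#` contain a defining equation of `y` or `z` and vanish;
        -- cancelling `y` leaves (1 - z) x = 1.
        identity : y * ((1# - z) * x) ≡ y * 1# + ((z - 1#) * ((1# - x) * y - 1#) + ((1# - y) * z - 1#))
        identity = solve 3 (λ x y z → y :* ((con ℤ.1ℤ :- z) :* x)
          := y :* con ℤ.1ℤ :+ ((z :- con ℤ.1ℤ) :* ((con ℤ.1ℤ :- x) :* y :- con ℤ.1ℤ) :+ ((con ℤ.1ℤ :- y) :* z :- con ℤ.1ℤ)))
          refl x y z

    möbius-fixed : ∀ {x} → möbius x ≡ x → ∃[ ω ] ω * ω + ω + 1# ≡ 0#
    möbius-fixed {zero}  ()
    möbius-fixed {suc x} = by-case (x ≟ 1#)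
      where
      by-case : (d : Dec (x ≡ 1#)) → möbius-finite x d ≡ suc x → ∃[ ω ] ω * ω + ω + 1# ≡ 0#
      by-case (no x≢1) eq = - x , trans
        (solve 1 (λ x → :- x :* :- x :+ :- x :+ con ℤ.1ℤ := con ℤ.1ℤ :- (con ℤ.1ℤ :- x) :* x) refl x)
        (x≈y⇒x∙y⁻¹≈ε (sym (trans (cong ((1# - x) *_) (sym (suc-injective eq))) (proj₂ (inverse (-≢0 (x≢1 ∘ sym)))))))

  abstract
    primitive-cube-root : ∃[ ω ] ω * ω + ω + 1# ≡ 0#
    primitive-cube-root = by-case (any? (λ x → möbius x ≟ x))
      where
      by-case : Dec (∃[ x ] möbius x ≡ x) → ∃[ ω ] ω * ω + ω + 1# ≡ 0#
      by-case (yes (x , fixed)) = möbius-fixed fixed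
      by-case (no none) = contradiction (fixedPointFree⇒3∣n möbius möbius³≡id λ x fixed → none (x , fixed)) 3∤1+p

  -- The cases where 2 or -1 is a nonsquare

  nonzero-square-*-nonsquare : ∀ {c x y} → c ≢ 0# → IsSquare c → ¬ IsSquare x → c * x ≡ y → NonsquareOrZero y
  nonzero-square-*-nonsquare c≢0 □c ¬□x cx≡y □y =
    contradiction (square-cancel c≢0 □c (subst IsSquare (sym cx≡y) □y)) ¬□x

  private
    ω : F
    ω = proj₁ primitive-cube-root

    ω²+ω+1≡0 : ω * ω + ω + 1# ≡ 0#
    ω²+ω+1≡0 = proj₂ primitive-cube-root

    -- Supplying the cofactor `c` of ω² + ω + 1 lets the solver treat `ω` as a free variable.
    modulo-ω : ∀ {x y} c → x ≡ y + c * (ω * ω + ω + 1#) → x ≡ y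
    modulo-ω {y = y} c eq = trans eq (trans (cong (λ z → y + c * z) ω²+ω+1≡0)
      (solve 2 (λ y c → y :+ c :* con ℤ.0ℤ := y) refl y c))

  -- The pairwise sums of 16, -12 and 9 are the squares 4, 25 and -3.
  case-2-nonsquare : ¬ IsSquare 2# → IntercalatedMate p
  case-2-nonsquare ¬□2 = FromSquares.intercalatedMate
    {red (+ 16)} {red (ℤ.- + 12)} {red (+ 9)}
    16≢0 -12≢0 9≢0
    -- The differences are 28, 7 and -21, nonzero because 2, 3 and 7 are.
    (λ 16≡-12 → *-≢0 4≢0 7≢0 (trans (solve 0 (con (+ 4) :* con (+ 7) := con (+ 16) :- con (ℤ.- + 12)) refl) (x≈y⇒x∙y⁻¹≈ε 16≡-12)))
    (λ 16≡9 → 7≢0 (trans (solve 0 (con (+ 7) := con (+ 16) :- con (+ 9)) refl) (x≈y⇒x∙y⁻¹≈ε 16≡9)))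
    (λ -12≡9 → *-≢0 -3≢0 7≢0 (trans (solve 0 (con (ℤ.- + 3) :* con (+ 7) := con (ℤ.- + 12) :- con (+ 9)) refl) (x≈y⇒x∙y⁻¹≈ε -12≡9)))
    □16
    (subst IsSquare (sym (red-* (+ 4) (ℤ.- + 3))) (square-* □4 □-3))
    □9
    2≢0
    (nonzero-square-*-nonsquare 4≢0 □4 ¬□2
      (solve 0 (con (+ 4) :* con (+ 2) := con (+ 2) :* (con (+ 16) :+ con (ℤ.- + 12))) refl))
    (nonzero-square-*-nonsquare 25≢0 □25 ¬□2
      (solve 0 (con (+ 25) :* con (+ 2) := con (+ 2) :* (con (+ 16) :+ con (+ 9))) refl))
    (nonzero-square-*-nonsquare -3≢0 □-3 ¬□2
      (solve 0 (con (ℤ.- + 3) :* con (+ 2) := con (+ 2) :* (con (ℤ.- + 12) :+ con (+ 9))) refl))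
    where
    product-≢0 : ∀ a b → red a ≢ 0# → red b ≢ 0# → red (a ℤ.* b) ≢ 0#
    product-≢0 a b a≢0 b≢0 = *-≢0 a≢0 b≢0 ∘ trans (sym (red-* a b))

    □red² : ∀ a → IsSquare (red (a ℤ.* a))
    □red² a = red a , sym (red-* a a)

    □4 = □red² (+ 2)
    □9 = □red² (+ 3)
    □16 = □red² (+ 4)
    □25 = □red² (+ 5)

    □-3 : IsSquare (red (ℤ.- + 3))
    -- The root is the difference of the two primitive cube roots: ω² - 2 ω³ + ω⁴ = ω² + ω - 2 = -3.
    □-3 = ω - ω * ω , modulo-ω (ω * ω - red (+ 3) * ω + red (+ 3))
      (solve 1 (λ ω → (ω :- ω :* ω) :* (ω :- ω :* ω)
        := con (ℤ.- + 3) :+ (ω :* ω :- con (+ 3) :* ω :+ con (+ 3)) :* (ω :* ω :+ ω :+ con ℤ.1ℤ)) refl ω)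

    4≢0 = product-≢0 (+ 2) (+ 2) 2≢0 2≢0
    9≢0 = product-≢0 (+ 3) (+ 3) 3≢0 3≢0
    16≢0 = product-≢0 (+ 4) (+ 4) 4≢0 4≢0
    25≢0 = product-≢0 (+ 5) (+ 5) 5≢0 5≢0

    -3≢0 : red (ℤ.- + 3) ≢ 0#
    -3≢0 -3≡0 = 3≢0 (trans (solve 0 (con (+ 3) := :- con (ℤ.- + 3)) refl)
      (trans (cong (λ x → - x) -3≡0) (solve 0 (:- con ℤ.0ℤ := con ℤ.0ℤ) refl)))

    -12≢0 = product-≢0 (+ 4) (ℤ.- + 3) 4≢0 -3≢0

    -- Modulo 7 the element 2 = 3² would be a square.
    7≢0 : red (+ 7) ≢ 0#
    7≢0 7≡0 = ¬□2 (subst IsSquare (x∙y⁻¹≈ε⇒x≈y _ _ (trans (solve 0 (con (+ 9) :- con (+ 2) := con (+ 7)) refl) 7≡0)) □9)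

  -- The three roots sum to zero, so any two of them sum to minus the third. Each root is a square,
  -- in particular ω = (ω²)², so every doubled sum is a nonzero square times -1.
  case-minus-1-nonsquare : IsSquare 2# → ¬ IsSquare (- 1#) → IntercalatedMate p
  case-minus-1-nonsquare □2 ¬□-1 = FromSquares.intercalatedMate
    {1#} {ω} {ω * ω}
    1≢0 ω≢0 ω²≢0 1≢ω
    (λ 1≡ω² → 1≢ω (*-cancelˡ ω≢0 (trans (*-comm ω 1#) (trans (cong (_* ω) 1≡ω²) (trans (*-assoc ω ω ω) (trans ω³≡1 1≡ω²))))))
    (λ ω≡ω² → 1≢ω (*-cancelˡ ω≢0 (trans (trans (*-comm ω 1#) (*-identityˡ ω)) ω≡ω²)))
    □1 □ω (ω , refl)
    2≢0
    (nonzero-square-*-nonsquare (*-≢0 2≢0 ω²≢0) (square-* □2 (ω , refl)) ¬□-1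
      (modulo-ω (- 2#) (solve 1 (λ ω → con (+ 2) :* (ω :* ω) :* :- con ℤ.1ℤ
        := con (+ 2) :* (con ℤ.1ℤ :+ ω) :+ :- con (+ 2) :* (ω :* ω :+ ω :+ con ℤ.1ℤ)) refl ω)))
    (nonzero-square-*-nonsquare (*-≢0 2≢0 ω≢0) (square-* □2 □ω) ¬□-1
      (modulo-ω (- 2#) (solve 1 (λ ω → con (+ 2) :* ω :* :- con ℤ.1ℤ
        := con (+ 2) :* (con ℤ.1ℤ :+ ω :* ω) :+ :- con (+ 2) :* (ω :* ω :+ ω :+ con ℤ.1ℤ)) refl ω)))
    (nonzero-square-*-nonsquare 2≢0 □2 ¬□-1
      (modulo-ω (- 2#) (solve 1 (λ ω → con (+ 2) :* :- con ℤ.1ℤ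
        := con (+ 2) :* (ω :+ ω :* ω) :+ :- con (+ 2) :* (ω :* ω :+ ω :+ con ℤ.1ℤ)) refl ω)))
    where
    ω³≡1 : ω * (ω * ω) ≡ 1#
    ω³≡1 = modulo-ω (ω - 1#) (solve 1 (λ ω → ω :* (ω :* ω)
      := con ℤ.1ℤ :+ (ω :- con ℤ.1ℤ) :* (ω :* ω :+ ω :+ con ℤ.1ℤ)) refl ω)

    □ω : IsSquare ω
    □ω = ω * ω , modulo-ω (ω * (ω - 1#)) (solve 1 (λ ω → (ω :* ω) :* (ω :* ω)
      := ω :+ ω :* (ω :- con ℤ.1ℤ) :* (ω :* ω :+ ω :+ con ℤ.1ℤ)) refl ω)

    ω≢0 : ω ≢ 0#
    ω≢0 ω≡0 = 1≢0 (trans (sym ω³≡1) (trans (cong (_* (ω * ω)) ω≡0) (*-zeroˡ _)))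

    ω²≢0 = *-≢0 ω≢0 ω≢0

    1≢ω : 1# ≢ ω
    1≢ω 1≡ω = 3≢0 (trans (solve 0 (con (+ 3) := con ℤ.1ℤ :* con ℤ.1ℤ :+ con ℤ.1ℤ :+ con ℤ.1ℤ) refl)
      (trans (cong (λ x → x * x + x + 1#) 1≡ω) ω²+ω+1≡0))

  -- The case where 2 and -1 are squares

  -- If no square lies between two nonsquares, then the nonsquares n inject into the
  -- squares other than 0 and -1: when n + 1 is a square, n ↦ -2 - n, since -1 - n is
  -- a square followed by the nonsquare -n; otherwise n ↦ -(n + 1) / n.
  -- But the nonzero squares inject into the nonsquares, a contradiction.
  module BetweenNonsquares (□2 : IsSquare 2#) (□-1 : IsSquare (- 1#)) where

    -1≢0 : - 1# ≢ 0#
    -1≢0 -1≡0 = 1≢0 (trans (solve 0 (con ℤ.1ℤ := con ℤ.0ℤ :- :- con ℤ.1ℤ) refl)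
      (trans (cong (λ x → 0# - x) -1≡0) (solve 0 (con ℤ.0ℤ :- con ℤ.0ℤ := con ℤ.0ℤ) refl)))

    □-neg : ∀ {x y} → x ≡ - 1# * y → IsSquare y → IsSquare x
    □-neg x≡-y □y = subst IsSquare (sym x≡-y) (square-* □-1 □y)

    private
      factor-≢0 : ∀ {x y} → x * y ≡ - 1# → x ≢ 0#
      factor-≢0 {y = y} xy≡-1 x≡0 = -1≢0 (trans (sym xy≡-1) (trans (cong (_* y) x≡0) (*-zeroˡ y)))

      undo : ∀ n → n ≡ - 1# * (- 1# * (n + 1#)) - 1#
      undo = solve 1 (λ n → n := :- con ℤ.1ℤ :* (:- con ℤ.1ℤ :* (n :+ con ℤ.1ℤ)) :- con ℤ.1ℤ) refl

    module _ (¬between : ∀ {x} → IsSquare x → ¬ IsSquare (x + 1#) → IsSquare (x - 1#)) where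

      -- The formulas y = -2 - n and y = -(n + 1) / n, both solved for y + 1; the second becomes y +
      -- 1 = -1 / n.
      Image : F → F → Set
      Image n y = (IsSquare (n + 1#) × y + 1# ≡ - 1# * (n + 1#)) ⊎ ((y + 1#) * n ≡ - 1#)

      -- The first equation makes y + 1 a square, and its product with `n` is the square -1. Hence
      -- the two formulas never share a value at nonsquares.
      image-mixed : ∀ {m n y} → IsSquare (m + 1#) → y + 1# ≡ - 1# * (m + 1#) → (y + 1#) * n ≡ - 1# → IsSquare n
      image-mixed □m+1 eq eq′ =
        square-cancel (factor-≢0 eq′) (□-neg eq □m+1) (subst IsSquare (sym eq′) □-1)

      image-injective : ∀ {m n y} → ¬ IsSquare m → ¬ IsSquare n → Image m y → Image n y → m ≡ n
      image-injective {m} {n} _ _ (inj₁ (_ , eq)) (inj₁ (_ , eq′)) = begin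
        m                          ≡⟨ undo m ⟩
        - 1# * (- 1# * (m + 1#)) - 1#  ≡⟨ cong (λ z → - 1# * z - 1#) (trans (sym eq) eq′) ⟩
        - 1# * (- 1# * (n + 1#)) - 1#  ≡⟨ undo n ⟨
        n                          ∎
        where
        open ≡-Reasoning
      image-injective _ ¬□n (inj₁ (□m+1 , eq)) (inj₂ eq′) = contradiction (image-mixed □m+1 eq eq′) ¬□n
      image-injective ¬□m _ (inj₂ eq) (inj₁ (□n+1 , eq′)) = contradiction (image-mixed □n+1 eq′ eq) ¬□m
      image-injective _ _ (inj₂ eq) (inj₂ eq′) = *-cancelˡ (factor-≢0 eq) (trans eq (sym eq′))

      -- The value 0 would come from n = -2 or n = -1, both squares.
      image-≢0 : ∀ {n} → ¬ IsSquare n → ∀ {y} → Image n y → y ≢ 0#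
      image-≢0 {n} ¬□n {y} (inj₁ (_ , eq)) y≡0 = ¬□n (□-neg n≡-2 □2)
        where
        n≡-2 : n ≡ - 1# * 2#
        n≡-2 = trans (undo n)
          (trans (cong (λ z → - 1# * z - 1#) (sym eq)) (trans (cong (λ y → - 1# * (y + 1#) - 1#) y≡0)
            (solve 0 (:- con ℤ.1ℤ :* (con ℤ.0ℤ :+ con ℤ.1ℤ) :- con ℤ.1ℤ := :- con ℤ.1ℤ :* con (+ 2)) refl)))
      image-≢0 {n} ¬□n {y} (inj₂ eq) y≡0 = ¬□n (subst IsSquare (sym n≡-1) □-1)
        where
        n≡-1 : n ≡ - 1#
        n≡-1 = trans (solve 1 (λ n → n := (con ℤ.0ℤ :+ con ℤ.1ℤ) :* n) refl n)
          (trans (cong (λ y → (y + 1#) * n) (sym y≡0)) eq)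

      image-≢-1 : ∀ {n} → ¬ IsSquare n → ∀ {y} → Image n y → y ≢ - 1#
      image-≢-1 {n} ¬□n {y} (inj₁ (_ , eq)) y≡-1 = ¬□n (subst IsSquare (sym n≡-1) □-1)
        where
        n≡-1 : n ≡ - 1#
        n≡-1 = trans (undo n)
          (trans (cong (λ z → - 1# * z - 1#) (sym eq)) (trans (cong (λ y → - 1# * (y + 1#) - 1#) y≡-1)
            (solve 0 (:- con ℤ.1ℤ :* (:- con ℤ.1ℤ :+ con ℤ.1ℤ) :- con ℤ.1ℤ := :- con ℤ.1ℤ) refl)))
      image-≢-1 _ (inj₂ eq) y≡-1 = factor-≢0 eq
        (trans (cong (_+ 1#) y≡-1) (solve 0 (:- con ℤ.1ℤ :+ con ℤ.1ℤ := con ℤ.0ℤ) refl))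

      image : ∀ {n} → ¬ IsSquare n → ∃[ y ] (IsSquare y × Image n y)
      image {n} ¬□n = by-case (square? (n + 1#))
        where
        by-case : Dec (IsSquare (n + 1#)) → ∃[ y ] (IsSquare y × Image n y)
        by-case (yes □n+1) = x - 1# , ¬between (□-neg refl □n+1) ¬□x+1 , inj₁ (□n+1 ,
          solve 1 (λ x → x :- con ℤ.1ℤ :+ con ℤ.1ℤ := x) refl x)
          where
          x = - 1# * (n + 1#)
          ¬□x+1 : ¬ IsSquare (x + 1#)
          ¬□x+1 = ¬□n ∘ □-neg (solve 1 (λ n → n := :- con ℤ.1ℤ :* (:- con ℤ.1ℤ :* (n :+ con ℤ.1ℤ) :+ con ℤ.1ℤ)) refl n)
        by-case (no ¬□n+1) = - 1# - n⁻¹ ,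
          -- Clearing denominators, n² y = -n (n + 1), and `n` and n + 1 are both nonsquares.
          square-cancel (*-≢0 n≢0 n≢0) (n , refl) (□-neg n²y≡ (nonsquare-*-nonsquare ¬□n ¬□n+1)) ,
          inj₂ (trans (solve 2 (λ n i → (:- con ℤ.1ℤ :- i :+ con ℤ.1ℤ) :* n := :- con ℤ.1ℤ :* (n :* i)) refl n n⁻¹)
            (trans (cong (- 1# *_) nn⁻¹≡1) (solve 0 (:- con ℤ.1ℤ :* con ℤ.1ℤ := :- con ℤ.1ℤ) refl)))
          where
          n≢0 = nonsquare-≢0 ¬□n
          n⁻¹ = proj₁ (inverse n≢0)
          nn⁻¹≡1 = proj₂ (inverse n≢0)
          n²y≡ : n * n * (- 1# - n⁻¹) ≡ - 1# * (n * (n + 1#))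
          n²y≡ = trans
            (solve 2 (λ n i → n :* n :* (:- con ℤ.1ℤ :- i) := :- con ℤ.1ℤ :* (n :* (n :+ n :* i))) refl n n⁻¹)
            (cong (λ e → - 1# * (n * (n + e))) nn⁻¹≡1)

      -- Squares go to `g` times squares and nonsquares go to squares, which glues the two
      -- injections into one self-map of the field.
      squares-exchange : ∀ g → ∀ {x} → Dec (IsSquare x) → F
      squares-exchange g {x} (yes _)  = g * x
      squares-exchange g     (no ¬□x) = proj₁ (image ¬□x)

      module _ {g} (¬□g : ¬ IsSquare g) where

        square-multiple-≡0 : ∀ {x} → IsSquare x → IsSquare (g * x) → g * x ≡ 0#
        square-multiple-≡0 {x} □x □gx = decidable-stable (g * x ≟ 0#) λ gx≢0 →
          ¬□g (square-cancel (λ x≡0 → gx≢0 (trans (cong (g *_) x≡0) (*-zeroʳ g))) □x (subst IsSquare (*-comm g x) □gx))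

        -- A collision between the branches would be a square of the form g x with `x` a square,
        -- hence 0, a value that `image` avoids.
        exchange-injective : ∀ {x y} (x? : Dec (IsSquare x)) (y? : Dec (IsSquare y)) →
          squares-exchange g x? ≡ squares-exchange g y? → x ≡ y
        exchange-injective (yes _) (yes _) eq = *-cancelˡ (nonsquare-≢0 ¬□g) eq
        exchange-injective (yes □x) (no ¬□y) eq = contradiction
          (trans (sym eq) (square-multiple-≡0 □x (subst IsSquare (sym eq) (proj₁ (proj₂ (image ¬□y))))))
          (image-≢0 ¬□y (proj₂ (proj₂ (image ¬□y))))
        exchange-injective (no ¬□x) (yes □y) eq = contradiction
          (trans eq (square-multiple-≡0 □y (subst IsSquare eq (proj₁ (proj₂ (image ¬□x))))))
          (image-≢0 ¬□x (proj₂ (proj₂ (image ¬□x))))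
        exchange-injective {y = y} (no ¬□x) (no ¬□y) eq = image-injective ¬□x ¬□y
          (proj₂ (proj₂ (image ¬□x))) (subst (Image y) (sym eq) (proj₂ (proj₂ (image ¬□y))))

        exchange-≢-1 : ∀ {x} (x? : Dec (IsSquare x)) → squares-exchange g x? ≢ - 1#
        exchange-≢-1 (yes □x) eq = -1≢0 (trans (sym eq) (square-multiple-≡0 □x (subst IsSquare (sym eq) □-1)))
        exchange-≢-1 (no ¬□x) = image-≢-1 ¬□x (proj₂ (proj₂ (image ¬□x)))

      -- An injective self-map of a finite set is onto, yet this one misses -1.
      between-absurd : ⊥
      between-absurd = exchange-≢-1 ¬□g (square? _) (proj₂ (exchange-surjective (- 1#)))
        where
        ¬□g = proj₂ nonsquare
        exchange-surjective : StrictlySurjective _≡_ (λ x → squares-exchange (proj₁ nonsquare) (square? x))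
        exchange-surjective = injective⇒strictlySurjective (exchange-injective ¬□g (square? _) (square? _))

    abstract
      square-between-nonsquares : ∃[ x ] (IsSquare x × ¬ IsSquare (x + 1#) × ¬ IsSquare (x - 1#))
      square-between-nonsquares = decidable-stable
        (any? λ x → square? x ×-dec (¬? (square? (x + 1#)) ×-dec ¬? (square? (x - 1#))))
        λ none → between-absurd λ {x} □x ¬□x+1 → decidable-stable (square? (x - 1#)) λ ¬□x-1 → none (x , □x , ¬□x+1 , ¬□x-1)

    case-squares : IntercalatedMate p
    case-squares with x , □x , ¬□x+1 , ¬□x-1 ← square-between-nonsquares =
      FromSquares.intercalatedMate {x} {1#} { - 1#}
        -- If `x` were 0, 1 or -1, then x + 1 would be one of the squares 1, 2, 0.
        (λ x≡0 → ¬□x+1 (subst IsSquare (sym (trans (cong (_+ 1#) x≡0) (+-identityˡ 1#))) □1))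
        1≢0 -1≢0
        (λ x≡1 → ¬□x+1 (subst IsSquare (sym (trans (cong (_+ 1#) x≡1)
          (solve 0 (con ℤ.1ℤ :+ con ℤ.1ℤ := con (+ 2)) refl))) □2))
        (λ x≡-1 → ¬□x+1 (subst IsSquare (sym (trans (cong (_+ 1#) x≡-1) (-‿inverseˡ 1#))) square-0))
        (1≢0 ∘ x≡-x⇒x≡0)
        □x □1 □-1
        2≢0
        (nonzero-square-*-nonsquare 2≢0 □2 ¬□x+1 refl)
        (nonzero-square-*-nonsquare 2≢0 □2 ¬□x-1 refl)
        -- The sum of 1 and -1 is zero, so the zero alternative of `NonsquareOrZero` applies.
        (λ _ → solve 0 (con (+ 2) :* (con ℤ.1ℤ :- con ℤ.1ℤ) := con ℤ.0ℤ) refl)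

  intercalated-mate : IntercalatedMate p
  intercalated-mate = by-case (square? 2#) (square? (- 1#))
    where
    by-case : Dec (IsSquare 2#) → Dec (IsSquare (- 1#)) → IntercalatedMate p
    by-case (no ¬□2)  _          = case-2-nonsquare ¬□2
    by-case (yes □2)  (no ¬□-1)  = case-minus-1-nonsquare □2 ¬□-1
    by-case (yes □2)  (yes □-1)  = BetweenNonsquares.case-squares □2 □-1

theorem7p1 : (p : ℕ) → Prime p → p % 6 ≡ 1 →
    ∃[ L ] (IsLatin {p} L × Orthogonal L (B p) × HasIntercalate L)
theorem7p1 = OneModSix.intercalated-mate
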